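{- Let $n\ge 1$. A word $w$ over $[n]$ fixes all $n$-component increasing networks if and only if $w$ is $n$-complete. Hence $\lambda_I(n)=\lambda(n)$.
   Context: An $n$-component (Boolean) network is a function $f=(f_1,\dots,f_n):\{0,1\}^n\to\{0,1\}^n$. Write $[n]=\{1,\dots,n\}$. The network $f$ is increasing if $x\le f(x)$ (componentwise) for all $x\in\{0,1\}^n$. For $i\in[n]$, $f^i(x):=(x_1,\dots,x_{i-1},f_i(x),x_{i+1},\dots,x_n)$, and for a word $w=i_1\dots i_k$ over $[n]$, $f^w:=f^{i_k}\circ\cdots\circ f^{i_1}$ (identity for the empty word). A word $w$ fixes $f$ if $f^w(x)$ is a fixed point of $f$ for every $x$. $\lambda_I(n)$ is the minimum length of a single word fixing all $n$-component increasing networks. A word is $n$-complete if it contains every permutation of $[n]$ (viewed as a word using each letter once) as a (not necessarily contiguous) subsequence; $\lambda(n)$ is the length of a shortest $n$-complete word. -}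

module Defs where

open import Data.Bool.Base as Bool using (Bool)
open import Data.Fin.Base using (Fin)
open import Data.List.Base using (List; []; _∷_; length; allFin)
open import Data.List.Relation.Binary.Permutation.Propositional using (_↭_)
open import Data.List.Relation.Binary.Sublist.Propositional using (_⊆_)
open import Data.Nat.Base using (ℕ; _≤_)
open import Data.Product.Base using (_×_; ∃-syntax)
open import Data.Vec.Base using (Vec; lookup; _[_]≔_)
open import Data.Vec.Relation.Binary.Pointwise.Inductive using (Pointwise)
open import Relation.Binary.PropositionalEquality.Core using (_≡_)

State : ℕ → Set
State n = Vec Bool n

Network : ℕ → Set
Network n = State n → State n

Word : ℕ → Set
Word n = List (Fin n)

Increasing : ∀ {n} → Network n → Set
Increasing {n} f = (x : State n) → Pointwise Bool._≤_ x (f x)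

update : ∀ {n} → Network n → Fin n → State n → State n
update f i x = x [ i ]≔ lookup (f x) i

-- f^w: the letters of w act from left to right, the first letter first.
run : ∀ {n} → Network n → Word n → State n → State n
run f []      x = x
run f (i ∷ w) x = run f w (update f i x)

Fixes : ∀ {n} → Word n → Network n → Set
Fixes {n} w f = (x : State n) → f (run f w x) ≡ run f w x

FixesAllIncreasing : ∀ {n} → Word n → Set
FixesAllIncreasing {n} w = (f : Network n) → Increasing f → Fixes w f

-- The permutations of [n], as words, are the rearrangements of allFin n;
-- _⊆_ on lists is the (not necessarily contiguous) subsequence relation.
Complete : ∀ {n} → Word n → Set
Complete {n} w = (u : Word n) → u ↭ allFin n → u ⊆ w

IsMinLength : ∀ {n} → (Word n → Set) → ℕ → Set
IsMinLength {n} P k =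
  (∃[ w ] (P w × length w ≡ k)) × ((w : Word n) → P w → k ≤ length w)

-- λ_I(n) = k and λ(n) = k, as relations: a minimum is determined by its
-- defining property, but its existence has to be asserted separately.
IsLambdaI : ℕ → ℕ → Set
IsLambdaI n = IsMinLength {n} FixesAllIncreasing

IsLambda : ℕ → ℕ → Set
IsLambda n = IsMinLength {n} Complete

{-# OPTIONS --safe #-}
module Submission where

-- If f is increasing and f^w(x) is not fixed, let i₁, …, iₖ be the components
-- in the order in which w switches them on, and let i be a component that is
-- still unstable at the end. Between two switches the state is constant, so
-- the switches occur at the greedy embedding of i₁ … iₖ into w, and i does not
-- occur after the last one. Hence i₁ … iₖ i is a repetition-free word that is
-- not a subsequence of w, and neither is any permutation that extends it.
--
-- Conversely, for a permutation u consider the increasing network that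
-- switches on the first letter of u that is still off. Started at 0, the word w
-- switches components on exactly along the greedy embedding of u into w, so
-- it reaches the only fixed point 1 only if u is a subsequence of w.

open import Defs
open import Data.Bool.Base as Bool using (true; false)
open import Data.Fin.Base using (Fin)
open import Data.Fin.Properties using (_≟_; any?; all?)
open import Data.List.Base
  using ([]; _∷_; _++_; _ʳ++_; length; allFin; filter; replicate; concat)
import Data.List.Membership.DecPropositional as DecMembership
open import Data.List.Membership.Propositional using (_∈_; _∉_)
open import Data.List.Membership.Propositional.Properties
  using (∈-allFin; ∈-++⁺ˡ; ∈-++⁺ʳ; ∈-filter⁺; ∈-filter⁻)
open import Data.List.Membership.Propositional.Properties.WithK using (unique∧set⇒bag)
open import Data.List.Properties using (length-tabulate)
open import Data.List.Relation.Binary.BagAndSetEquality using (∼bag⇒↭)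
open import Data.List.Relation.Binary.Permutation.Propositional using (_↭_; ↭-sym; ↭⇒↭ₛ)
open import Data.List.Relation.Binary.Permutation.Propositional.Properties
  using (↭-length; ∈-resp-↭)
import Data.List.Relation.Binary.Permutation.Setoid.Properties as Permutationₛ
import Data.List.Relation.Binary.Sublist.DecPropositional as DecSublist
open import Data.List.Relation.Binary.Sublist.Propositional
  using (_⊆_; []; _∷_; _∷ʳ_; minimum; from∈; ⊆-trans; ⊆-refl)
open import Data.List.Relation.Binary.Sublist.Propositional.Properties using (++⁺; ++⁺ʳ; ∷⁻)
open import Data.List.Relation.Unary.All as All using (All; []; _∷_)
open import Data.List.Relation.Unary.AllPairs using ([]; _∷_)
import Data.List.Relation.Unary.Unique.DecPropositional as DecUnique
open import Data.List.Relation.Unary.Unique.Propositional using (Unique)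
import Data.List.Relation.Unary.Unique.Propositional.Properties as Unique
open import Data.Nat.Base using (ℕ; zero; suc; _≤_; _<_)
open import Data.Nat.Induction using (<-rec)
open import Data.Nat.Properties using (anyUpTo?; ≤-antisym; ≮⇒≥)
open import Data.Product.Base using (_×_; _,_; ∃; ∃-syntax; ∃₂; proj₁; proj₂)
open import Data.Sum.Base using (_⊎_; inj₁; inj₂)
open import Data.Vec.Base using (lookup; _[_]≔_) renaming (replicate to constant)
open import Data.Vec.Properties
  using (lookup∘update; lookup∘update′; []≔-lookup; lookup-replicate)
open import Data.Vec.Relation.Binary.Pointwise.Extensional using (ext; extensional⇒inductive)
open import Data.Vec.Relation.Binary.Pointwise.Inductive as Pointwise
  using (Pointwise-≡⇒≡)
open import Function.Base using (_∘_; id)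
open import Function.Bundles using (_⇔_; mk⇔)
open import Relation.Binary.PropositionalEquality.Core
  using (_≡_; _≢_; refl; sym; trans; cong; subst)
open import Relation.Binary.PropositionalEquality.Properties using (setoid)
open import Relation.Nullary.Decidable using (Dec; yes; no; ¬?; map′; _×-dec_; decidable-stable)
open import Relation.Nullary.Negation using (¬_; contradiction)
open import Relation.Unary using (Decidable)

private
  variable
    n : ℕ

module _ {n : ℕ} where
  open DecMembership (_≟_ {n}) public using (_∈?_)
  open DecSublist (_≟_ {n}) public using (_⊆?_)
  open DecUnique (_≟_ {n}) public using (unique?)

-- Permutations as repetition-free words using every letter.

Unique-↭-allFin : {u : Word n} → u ↭ allFin n → Unique u
Unique-↭-allFin {n} u↭ =
  Permutationₛ.Unique-resp-↭ (setoid (Fin n)) (↭⇒↭ₛ (↭-sym u↭)) (Unique.allFin⁺ n)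

-- Repetition-free words with the same letters contain each letter equally often, hence are
-- rearrangements of each other.
unique∧full⇒↭-allFin : {u : Word n} → Unique u → (∀ i → i ∈ u) → u ↭ allFin n
unique∧full⇒↭-allFin {n} u! full =
  ∼bag⇒↭ (unique∧set⇒bag u! (Unique.allFin⁺ n) (mk⇔ (λ _ → ∈-allFin _) (λ _ → full _)))

↭-allFin? : Decidable {A = Word n} (_↭ allFin n)
↭-allFin? u = map′
  (λ (u! , full) → unique∧full⇒↭-allFin u! full)
  (λ u↭ → Unique-↭-allFin u↭ , λ i → ∈-resp-↭ (↭-sym u↭) (∈-allFin i))
  (unique? u ×-dec all? (_∈? u))

unique⇒⊆permutation : {u : Word n} → Unique u → ∃[ v ] (v ↭ allFin n × u ⊆ v)
unique⇒⊆permutation {n} {u} u! =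
  u ++ rest , unique∧full⇒↭-allFin unique full , ++⁺ʳ rest ⊆-refl
  where
  ∉u? : Decidable (_∉ u)
  ∉u? i = ¬? (i ∈? u)

  rest : Word n
  rest = filter ∉u? (allFin n)

  unique : Unique (u ++ rest)
  unique = Unique.++⁺ u! (Unique.filter⁺ ∉u? (Unique.allFin⁺ n))
    λ (i∈u , i∈rest) → proj₂ (∈-filter⁻ ∉u? {xs = allFin n} i∈rest) i∈u

  full : ∀ i → i ∈ u ++ rest
  full i with i ∈? u
  ... | yes i∈u = ∈-++⁺ˡ i∈u
  ... | no  i∉u = ∈-++⁺ʳ u (∈-filter⁺ ∉u? (∈-allFin i) i∉u)

-- Complete words fix increasing networks.

Off : State n → Fin n → Set
Off x i = lookup x i ≡ false

On : State n → Fin n → Set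
On x i = lookup x i ≡ true

Unstable : Network n → State n → Fin n → Set
Unstable f x i = Off x i × On (f x) i

update-stable : ∀ (f : Network n) x {i} → lookup (f x) i ≡ lookup x i → update f i x ≡ x
update-stable f x {i} stable = trans (cong (x [ i ]≔_) stable) ([]≔-lookup x i)

≤⇒switch⊎≡ : ∀ {a b} → a Bool.≤ b → (a ≡ false × b ≡ true) ⊎ b ≡ a
≤⇒switch⊎≡ Bool.f≤t = inj₁ (refl , refl)
≤⇒switch⊎≡ Bool.b≤b = inj₂ refl

module _ {f : Network n} (incr : Increasing f) where

  unstable⊎stable : ∀ x i → Unstable f x i ⊎ lookup (f x) i ≡ lookup x i
  unstable⊎stable x i = ≤⇒switch⊎≡ (Pointwise.lookup (incr x) i)

  no-unstable⇒fixed : ∀ x → (∀ i → ¬ Unstable f x i) → f x ≡ x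
  no-unstable⇒fixed x none = Pointwise-≡⇒≡ (extensional⇒inductive (ext stable))
    where
    stable : ∀ i → lookup (f x) i ≡ lookup x i
    stable i with unstable⊎stable x i
    ... | inj₁ unst = contradiction unst (none i)
    ... | inj₂ eq   = eq

  -- That the first letter is unstable at x is what lets a non-switching letter
  -- of w be dropped in the induction: it cannot be the first letter.
  unstable⇒missing : ∀ w x {i} → Unstable f (run f w x) i →
    ∃₂ λ h t → Unstable f x h × All (Off x) (h ∷ t) × Unique (h ∷ t) × ¬ (h ∷ t ⊆ w)
  unstable⇒missing [] x {i} unst =
    -- Nothing is left to run, so the one-letter word `i` is already missing.
    i , [] , unst , proj₁ unst ∷ [] , [] ∷ [] , λ ()
  unstable⇒missing (j ∷ w) x unst with unstable⊎stable x j
  ... | inj₂ stable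
    with unstable⇒missing w x
           (subst (λ y → Unstable f (run f w y) _) (update-stable f x stable) unst)
  ... | h , t , (h-off , h-on) , off , u! , u⊈w =
    h , t , (h-off , h-on) , off , u! , λ where
      (_ ∷ʳ u⊆w) → u⊈w u⊆w
      (refl ∷ _) → contradiction (trans (sym h-on) (trans stable h-off)) λ ()
  unstable⇒missing (j ∷ w) x unst | inj₁ (xj-off , fxj-on)
    with unstable⇒missing w (update f j x) unst
  ... | h , t , _ , off , u! , u⊈w =
    -- After its update `j` is on while all of `h ∷ t` is off, so `j` is a new letter. Embedding
    -- `j ∷ h ∷ t` into `j ∷ w` would embed `h ∷ t` into `w`.
    j , h ∷ t , (xj-off , fxj-on)
    , xj-off ∷ All.map still-off off
    , All.map off⇒j≢ off ∷ u!
    , u⊈w ∘ ∷⁻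
    where
    off⇒j≢ : ∀ {k} → Off (update f j x) k → j ≢ k
    off⇒j≢ k-off refl with () ← trans (sym k-off) (trans (lookup∘update j x _) fxj-on)

    still-off : ∀ {k} → Off (update f j x) k → Off x k
    still-off k-off = trans (sym (lookup∘update′ (off⇒j≢ k-off ∘ sym) x _)) k-off

complete⇒fixes : {w : Word n} → Complete w → FixesAllIncreasing w
complete⇒fixes {w = w} complete f incr x = no-unstable⇒fixed incr _ λ i unst →
  let _ , _ , _ , _ , u! , u⊈w = unstable⇒missing incr w x unst
      v , v↭ , u⊆v             = unique⇒⊆permutation u!
  in u⊈w (⊆-trans u⊆v (complete v v↭))

-- Words fixing all increasing networks are complete.

switchFirst : Word n → Network n
switchFirst []      x = x
switchFirst (i ∷ u) x = Bool.if lookup x i then switchFirst u x else x [ i ]≔ true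

switchFirst-increasing : (u : Word n) → Increasing (switchFirst u)
switchFirst-increasing []      x = Pointwise.refl Bool.b≤b
switchFirst-increasing (i ∷ u) x with lookup x i in x[i]
... | true  = switchFirst-increasing u x
... | false = extensional⇒inductive (ext x≤)
  where
  x≤ : ∀ k → lookup x k Bool.≤ lookup (x [ i ]≔ true) k
  x≤ k with k ≟ i
  ... | yes refl rewrite x[i] | lookup∘update i x true = Bool.f≤t
  ... | no  k≢i  rewrite lookup∘update′ k≢i x true     = Bool.b≤b

switchFirst-off : ∀ {i} (u : Word n) x → Off x i → switchFirst (i ∷ u) x ≡ x [ i ]≔ true
switchFirst-off u x off rewrite off = refl

switchFirst-ʳ++ : ∀ p {v : Word n} {x} → All (On x) p →
  switchFirst (p ʳ++ v) x ≡ switchFirst v x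
switchFirst-ʳ++ []      []                 = refl
switchFirst-ʳ++ (i ∷ p) {v} {x} (on ∷ ons) = trans (switchFirst-ʳ++ p ons) skip
  where
  skip : switchFirst (i ∷ v) x ≡ switchFirst v x
  skip rewrite on = refl

update-on : ∀ {i k} (x : State n) → On x k → On (x [ i ]≔ true) k
update-on {i = i} {k} x on with k ≟ i
... | yes refl = lookup∘update i x true
... | no  k≢i  = trans (lookup∘update′ k≢i x true) on

-- p lists the components switched on so far, last one first, and v is the
-- rest of the permutation p ʳ++ v.
fixed⇒⊆ : ∀ (w p v : Word n) x → Unique v → All (On x) p → All (Off x) v →
  (let f = switchFirst (p ʳ++ v)) → f (run f w x) ≡ run f w x → v ⊆ w
fixed⇒⊆ w p [] x _ _ _ _ = minimum w
fixed⇒⊆ [] p (i ∷ v) x _ on (i-off ∷ _) fixed =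
  -- With no letters left to run, `x` itself would be fixed, yet the network still switches `i` on.
  contradiction (trans (sym i-off) i-on) λ ()
  where
  x≡ : x ≡ x [ i ]≔ true
  x≡ = trans (sym fixed) (trans (switchFirst-ʳ++ p on) (switchFirst-off v x i-off))

  i-on : On x i
  i-on = trans (cong (λ y → lookup y i) x≡) (lookup∘update i x true)
fixed⇒⊆ {n} (j ∷ w) p (i ∷ v) x (i∉v ∷ v!) on (i-off ∷ off) fixed = step (j ≟ i)
  where
  f : Network n
  f = switchFirst (p ʳ++ i ∷ v)

  fx≡ : f x ≡ x [ i ]≔ true
  fx≡ = trans (switchFirst-ʳ++ p on) (switchFirst-off v x i-off)

  fixed-from : ∀ {y} → update f j x ≡ y → f (run f w y) ≡ run f w y
  fixed-from eq = subst (λ y → f (run f w y) ≡ run f w y) eq fixed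

  step : Dec (j ≡ i) → i ∷ v ⊆ j ∷ w
  -- `(i ∷ p) ʳ++ v` reduces to `p ʳ++ i ∷ v`, so the recursive call concerns the same network `f`.
  step (yes refl) = refl ∷ fixed⇒⊆ w (i ∷ p) v (x [ i ]≔ true) v!
    (lookup∘update i x true ∷ All.map (update-on x) on)
    (All.zipWith (λ (i≢k , k-off) → trans (lookup∘update′ (i≢k ∘ sym) x true) k-off) (i∉v , off))
    (fixed-from (cong (x [ i ]≔_) (trans (cong (λ y → lookup y i) fx≡) (lookup∘update i x true))))
  step (no j≢i) = j ∷ʳ fixed⇒⊆ w p (i ∷ v) x (i∉v ∷ v!) on (i-off ∷ off) (fixed-from unchanged)
    where
    -- At `x` the network changes component `i` only, so any other letter has no effect.
    unchanged : update f j x ≡ x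
    unchanged = update-stable f x
      (trans (cong (λ y → lookup y j) fx≡) (lookup∘update′ j≢i x true))

fixes⇒complete : {w : Word n} → FixesAllIncreasing w → Complete w
fixes⇒complete {n} {w} fixes u u↭ =
  fixed⇒⊆ w [] u 0ˢ (Unique-↭-allFin u↭) [] (All.universal (λ i → lookup-replicate i false) u)
    (fixes (switchFirst u) (switchFirst-increasing u) 0ˢ)
  where
  0ˢ : State n
  0ˢ = constant n false

fixes⇔complete : (w : Word n) → FixesAllIncreasing w ⇔ Complete w
fixes⇔complete w = mk⇔ fixes⇒complete complete⇒fixes

-- Existence of the minimum lengths, by finite search.

anyWord? : {P : Word n → Set} → Decidable P → ∀ k → Dec (∃[ u ] (P u × length u ≡ k))
anyWord? P? zero = map′
  (λ p → [] , p , refl)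
  (λ where ([] , p , _) → p)
  (P? [])
anyWord? P? (suc k) = map′
  (λ where (i , u , p , refl) → i ∷ u , p , refl)
  (λ where (i ∷ u , p , refl) → i , u , p , refl)
  (any? λ i → anyWord? (λ u → P? (i ∷ u)) k)

length-↭-allFin : {u : Word n} → u ↭ allFin n → length u ≡ n
length-↭-allFin u↭ = trans (↭-length u↭) (length-tabulate id)

-- All permutations have length `n`, so a missed one can be searched for among finitely many words.
complete? : Decidable {A = Word n} Complete
complete? {n} w = map′
  (λ none u u↭ → decidable-stable (u ⊆? w) λ u⊈w →
    none (u , (u↭ , u⊈w) , length-↭-allFin u↭))
  (λ complete (u , (u↭ , u⊈w) , _) → u⊈w (complete u u↭))
  (¬? (anyWord? (λ u → ↭-allFin? u ×-dec ¬? (u ⊆? w)) n))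

⊆-concat-replicate-allFin : (u : Word n) → u ⊆ concat (replicate (length u) (allFin n))
⊆-concat-replicate-allFin []      = []
⊆-concat-replicate-allFin (i ∷ u) = ++⁺ (from∈ (∈-allFin i)) (⊆-concat-replicate-allFin u)

complete-exists : ∀ n → ∃ (Complete {n})
-- The inferred witness is `n` concatenated copies of `allFin n`; each copy supplies one letter of
-- `u`.
complete-exists n = _ , λ u u↭ →
  subst (λ k → u ⊆ concat (replicate k (allFin n))) (length-↭-allFin u↭)
    (⊆-concat-replicate-allFin u)

-- Well-founded descent: a bounded search either finds a smaller number satisfying `P` or certifies
-- that the current one is least.
least : {P : ℕ → Set} → Decidable P → ∃ P → ∃[ k ] (P k × (∀ m → P m → k ≤ m))
least {P} P? (m₀ , p₀) = <-rec _ descend m₀ p₀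
  where
  descend : ∀ m → (∀ {k} → k < m → P k → _) → P m → ∃[ k ] (P k × (∀ m → P m → k ≤ m))
  descend m below p with anyUpTo? P? m
  ... | yes (k , k<m , q) = below k<m q
  ... | no  none          = m , p , λ k q → ≮⇒≥ λ k<m → none (k , k<m , q)

-- Minimise over the lengths that occur, a set of numbers decidable by `anyWord?`.
minLength-exists : {P : Word n → Set} → Decidable P → ∃ P → ∃[ k ] IsMinLength P k
minLength-exists P? (w , p) =
  let k , shortest , k≤ = least (anyWord? P?) (length w , w , p , refl)
  in k , shortest , λ v q → k≤ (length v) (v , q , refl)

minLength-⊆ : {P Q : Word n → Set} → (∀ w → P w → Q w) →
  ∀ {k l} → IsMinLength P k → IsMinLength Q l → l ≤ k
minLength-⊆ P⊆Q ((w , p , refl) , _) (_ , l≤) = l≤ w (P⊆Q w p)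

proposition3 : (n : ℕ) → 1 ≤ n →
    ((w : Word n) → FixesAllIncreasing w ⇔ Complete w)
    × (∃[ k ] IsLambdaI n k)
    × (∃[ l ] IsLambda n l)
    × ((k l : ℕ) → IsLambdaI n k → IsLambda n l → k ≡ l)
proposition3 n _ =
    fixes⇔complete
  , minLength-exists
      -- Networks are not enumerated: decidability is transferred from `complete?` along the
      -- equivalence.
      (λ w → map′ complete⇒fixes fixes⇒complete (complete? w))
      (proj₁ (complete-exists n) , complete⇒fixes (proj₂ (complete-exists n)))
  , minLength-exists complete? (complete-exists n)
  , λ k l minI minC → ≤-antisym
      (minLength-⊆ (λ _ → complete⇒fixes) minC minI)
      (minLength-⊆ (λ _ → fixes⇒complete) minI minC)
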